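{- Let $M$ be an $L$-structure and $\phi(x,y)$ an $L$-formula. Let $\epsilon>0$ and suppose $\phi(x,y)$ is $\epsilon$-stable in $M$. Fix $\gamma>\delta>0$ and let $p\in S_{\phi(x)}(M)$. Then there are finitely many $a_0,\ldots,a_{n-1}\in M^x$ such that, for all $b,c\in M^y$, if $\mathfrak d(\phi^M(a_i,b),\phi^M(a_i,c))<\delta$ for all $i<n$, then $\mathfrak d(\phi(p,b),\phi(p,c))<2\epsilon+\gamma$.
   Context: Logic: We work in continuous (metric) first-order logic with values in $\mathfrak V=\ell^\infty(\omega)$ (real Banach space), with metric $\mathfrak d(\mathfrak r,\mathfrak s)=\|\mathfrak r-\mathfrak s\|_\infty$; an isometric copy $\mathbb R\hookrightarrow\mathfrak V$ is fixed. It is set up as standard $[0,1]$-valued continuous logic (complete metric structures, possibly many-sorted, symbols with prescribed moduli of uniform continuity), except that each predicate symbol $P$ of the language $L$ comes with a compact set $K_P\subseteq\mathfrak V$ in which it takes values; connectives are all continuous functions $u:\mathfrak V^n\to\mathfrak V$; and $\sup_x\psi$, $\inf_x\psi$ are formed only for formulas $\psi$ with value set $K_\psi\subseteq\mathbb R^{\geq0}$. Inductively each formula $\phi$ has a compact value set $K_\phi\subseteq\mathfrak V$ ($K_{u(\phi_0,\ldots,\phi_{n-1})}=u(\prod_i K_{\phi_i})$, and $K_{\sup_x\psi}=K_{\inf_x\psi}=K_\psi$), and $\phi^M$ takes values in $K_\phi$ in every $L$-structure $M$. Here $x,y$ are tuples of variables and $M^x$ is the product of sorts of $M$ corresponding to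 $x$. $N\succeq M$ means $N$ is an elementary extension of $M$. Types: $S_{\phi(x)}(M)$ is the set of complete $\phi(x)$-types over $M$. A type $p\in S_{\phi(x)}(M)$ is determined by the function $b\mapsto\phi(p,b)$ from $M^y$ to $K_\phi$, where $\phi(p,b)=\phi^N(a,b)$ for any realization $a\in N^x$ of $p$ in some $N\succeq M$. Stability: $\phi(x,y)$ is $\epsilon$-stable in $M$ if there are no sequences $\langle a_i\rangle_{i<\omega}$ in $M^x$ and $\langle b_i\rangle_{i<\omega}$ in $M^y$ such that $\mathfrak d(\phi^M(a_i,b_j),\phi^M(a_j,b_i))\geq\epsilon$ for all $i<j<\omega$. -}

module Defs where

open import Algebra.Bundles using (CommutativeRing)
import Algebra.Construct.NaturalChoice.Max as Max
import Algebra.Construct.NaturalChoice.MaxOp as MaxOp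
import Algebra.Properties.AbelianGroup as AbelianGroupProperties
open import Axiom.ExcludedMiddle using (ExcludedMiddle)
open import Data.Fin.Base using (Fin)
open import Data.List.Base using (List; []; _∷_; _++_)
open import Data.List.Membership.Propositional using (_∈_)
open import Data.List.Relation.Unary.All as All using (All; []; _∷_)
open import Data.List.Relation.Unary.All.Properties using (++⁺)
open import Data.List.Relation.Unary.Any using (Any)
import Data.Nat.Base as ℕ
open import Data.Nat.Base using (ℕ)
open import Data.Product.Base using (Σ; ∃; _×_; _,_; proj₁; proj₂)
open import Data.Vec.Functional using (Vector)
open import Function.Metric.Structures using (IsGeneralMetric)
open import Level using (0ℓ)
open import Relation.Binary.Bundles using (TotalOrder)
open import Relation.Binary.Core using (Rel)
open import Relation.Binary.Definitions using (_Respects_)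
open import Relation.Binary.Structures using (IsTotalOrder)
import Relation.Binary.Construct.NonStrictToStrict as NonStrictToStrict
open import Relation.Nullary using (¬_; yes; no)
open import Relation.Unary using (Pred)

module _ {A : Set} (_≤_ : Rel A 0ℓ) where

  UpperBound LowerBound IsLub IsGlb : Pred A 0ℓ → Pred A 0ℓ
  UpperBound P b = ∀ x → P x → x ≤ b
  LowerBound P b = ∀ x → P x → b ≤ x
  IsLub P s = UpperBound P s × (∀ b → UpperBound P b → s ≤ b)
  IsGlb P s = LowerBound P s × (∀ b → LowerBound P b → b ≤ s)

-- The library has no real numbers. We axiomatise them as a Dedekind-complete
-- ordered field, which classically determines ℝ up to unique isomorphism.

record CompleteOrderedField : Set₁ where
  field
    commutativeRing : CommutativeRing 0ℓ 0ℓ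
  open CommutativeRing commutativeRing public
  field
    _≤_          : Rel Carrier 0ℓ
    isTotalOrder : IsTotalOrder _≈_ _≤_
    +-monoˡ-≤    : ∀ z {x y} → x ≤ y → (x + z) ≤ (y + z)
    *-nonNeg     : ∀ {x y} → 0# ≤ x → 0# ≤ y → 0# ≤ (x * y)
    0≉1          : ¬ (0# ≈ 1#)
    inverse      : ∀ x → ¬ (x ≈ 0#) → ∃ λ y → (x * y) ≈ 1#
    complete     : ∀ P → ∃ P → ∃ (UpperBound _≤_ P) → ∃ (IsLub _≤_ P)

  totalOrder : TotalOrder 0ℓ 0ℓ 0ℓ
  totalOrder = record { isTotalOrder = isTotalOrder }

  open IsTotalOrder isTotalOrder public
    using (total; antisym; ≤-respˡ-≈; ≤-respʳ-≈)
    renaming (refl to ≤-refl; reflexive to ≤-reflexive; trans to ≤-trans)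
  open NonStrictToStrict _≈_ _≤_ public using (_<_)
  open Max totalOrder public using (_⊔_)

  ∣_∣ : Carrier → Carrier
  ∣ x ∣ = x ⊔ (- x)

  infix 4 _≤_

-- The value space ℓ^∞(ω).

module Values (R : CompleteOrderedField) where

  open CompleteOrderedField R
    renaming ( Carrier to ℝ; _≈_ to _≈ᵣ_; _+_ to _+ᵣ_; _-_ to _-ᵣ_
             ; -_ to -ᵣ_; _≤_ to _≤ᵣ_; _<_ to _<ᵣ_; ∣_∣ to ∣_∣ᵣ
             ; refl to ≈ᵣ-refl; sym to ≈ᵣ-sym; trans to ≈ᵣ-trans )
    hiding (distrib; zero)

  record 𝔙 : Set where
    constructor mk𝔙
    field
      seq     : ℕ → ℝ
      bounded : ∃ λ B → ∀ n → ∣ seq n ∣ᵣ ≤ᵣ B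
  open 𝔙 public

  infix 4 _≈_
  _≈_ : Rel 𝔙 0ℓ
  r ≈ s = ∀ n → seq r n ≈ᵣ seq s n

  private
    open MaxOp (Max.maxOperator totalOrder)
      using (⊔-lub; x≤x⊔y; x≤y⊔x)
    open AbelianGroupProperties +-abelianGroup using (⁻¹-anti-homo‿-)

    +-mono : ∀ {a b c d} → a ≤ᵣ b → c ≤ᵣ d → (a +ᵣ c) ≤ᵣ (b +ᵣ d)
    +-mono {a} {b} {c} {d} a≤b c≤d = ≤-trans (+-monoˡ-≤ c a≤b)
      (≤-respˡ-≈ (+-comm c b) (≤-respʳ-≈ (+-comm d b) (+-monoˡ-≤ b c≤d)))

    ∣x-y∣≤ : ∀ {x y B C} → ∣ x ∣ᵣ ≤ᵣ B → ∣ y ∣ᵣ ≤ᵣ C → ∣ x -ᵣ y ∣ᵣ ≤ᵣ (B +ᵣ C)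
    ∣x-y∣≤ {x} {y} {B} {C} ∣x∣≤B ∣y∣≤C = ⊔-lub
      (+-mono (≤-trans (x≤x⊔y x (-ᵣ x)) ∣x∣≤B) (≤-trans (x≤y⊔x y (-ᵣ y)) ∣y∣≤C))
      (≤-respˡ-≈ (≈ᵣ-sym (⁻¹-anti-homo‿- x y)) (≤-respʳ-≈ (+-comm C B)
        (+-mono (≤-trans (x≤x⊔y y (-ᵣ y)) ∣y∣≤C)
                (≤-trans (x≤y⊔x x (-ᵣ x)) ∣x∣≤B))))

  _-_ : 𝔙 → 𝔙 → 𝔙
  seq     (r - s) n = seq r n -ᵣ seq s n
  bounded (r - s)   = proj₁ (bounded r) +ᵣ proj₁ (bounded s)
                    , λ n → ∣x-y∣≤ (proj₂ (bounded r) n) (proj₂ (bounded s) n)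

  private
    supNorm : ∀ r → ∃ (IsLub _≤ᵣ_ (λ t → ∃ λ n → t ≈ᵣ ∣ seq r n ∣ᵣ))
    supNorm r = complete _ (∣ seq r 0 ∣ᵣ , 0 , ≈ᵣ-refl)
      ( proj₁ (bounded r)
      , λ { t (n , t≈) → ≤-respˡ-≈ (≈ᵣ-sym t≈) (proj₂ (bounded r) n) })

  ‖_‖ : 𝔙 → ℝ
  ‖ r ‖ = proj₁ (supNorm r)

  ‖‖-isLub : ∀ r → IsLub _≤ᵣ_ (λ t → ∃ λ n → t ≈ᵣ ∣ seq r n ∣ᵣ) ‖ r ‖
  ‖‖-isLub r = proj₂ (supNorm r)

  𝔡 : 𝔙 → 𝔙 → ℝ
  𝔡 r s = ‖ r - s ‖

  Open : Pred 𝔙 0ℓ → Set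
  Open U = ∀ r → U r → ∃ λ ρ → (0# <ᵣ ρ) × (∀ s → 𝔡 r s <ᵣ ρ → U s)

  record IsCompact (K : Pred 𝔙 0ℓ) : Set₁ where
    field
      respects   : K Respects _≈_
      heineBorel : {I : Set} (U : I → Pred 𝔙 0ℓ) → (∀ i → Open (U i)) →
                   (∀ r → K r → ∃ λ i → U i r) →
                   ∃ λ (is : List I) → ∀ r → K r → Any (λ i → U i r) is

  -- Continuity for the maximum metric on 𝔙ⁿ. At distance 0 this also forces
  -- u to respect _≈_.
  Continuous : ∀ {n} → (Vector 𝔙 n → 𝔙) → Set
  Continuous u = ∀ r ε → 0# <ᵣ ε → ∃ λ δ → (0# <ᵣ δ) ×
    (∀ s → (∀ i → 𝔡 (r i) (s i) <ᵣ δ) → 𝔡 (u r) (u s) <ᵣ ε)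

  record IsometricCopy : Set where
    field
      ι        : ℝ → 𝔙
      isometry : ∀ s t → 𝔡 (ι s) (ι t) ≈ᵣ ∣ s -ᵣ t ∣ᵣ

-- Excluded middle is used only to define suprema and infima as total
-- functions.

module ContinuousLogic
  (em : ∀ {ℓ} → ExcludedMiddle ℓ)
  (R : CompleteOrderedField)
  (E : Values.IsometricCopy R)
  where

  open CompleteOrderedField R public
    using (0#; 1#; _+_; _*_; _≤_; _<_; ∣_∣; _⊔_)
    renaming (Carrier to ℝ; _≈_ to _≈ᵣ_)
  open Values R public
  open IsometricCopy E public

  ℝ≥0 : Pred 𝔙 0ℓ
  ℝ≥0 r = ∃ λ t → (0# ≤ t) × (r ≈ ι t)

  -- The value 0 is a dummy for sets without a supremum (infimum).
  supremum infimum : Pred ℝ 0ℓ → ℝ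
  supremum P with em {P = ∃ (IsLub _≤_ P)}
  ... | yes (s , _) = s
  ... | no  _       = 0#
  infimum P with em {P = ∃ (IsGlb _≤_ P)}
  ... | yes (s , _) = s
  ... | no  _       = 0#

  -- Sorts are setoids, so that `IsGeneralMetric` below says that points at
  -- distance 0 are equal in the sense of the setoid.
  record CompleteMetricSpace : Set₁ where
    field
      Carrier  : Set
      _≈ₘ_     : Rel Carrier 0ℓ
      d        : Carrier → Carrier → ℝ
      isMetric : IsGeneralMetric _≈ₘ_ _≈ᵣ_ _≤_ 0# _+_ d
      point    : Carrier
      d≤1      : ∀ a b → d a b ≤ 1#

    Cauchy : (ℕ → Carrier) → Set
    Cauchy a = ∀ ε → 0# < ε → ∃ λ k → ∀ m n → k ℕ.≤ m → k ℕ.≤ n →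
               d (a m) (a n) < ε

    ConvergesTo : (ℕ → Carrier) → Carrier → Set
    ConvergesTo a l = ∀ ε → 0# < ε → ∃ λ k → ∀ n → k ℕ.≤ n → d (a n) l < ε

    field
      complete : ∀ a → Cauchy a → ∃ (ConvergesTo a)

  module Product {S : Set} (space : S → CompleteMetricSpace) where

    ⟨_⟩ : S → Set
    ⟨ s ⟩ = CompleteMetricSpace.Carrier (space s)

    distₛ : ∀ s → ⟨ s ⟩ → ⟨ s ⟩ → ℝ
    distₛ s = CompleteMetricSpace.d (space s)

    Tuple : List S → Set
    Tuple = All ⟨_⟩

    maxDist : ∀ {x} → Tuple x → Tuple x → ℝ
    maxDist         []       []       = 0#
    maxDist {s ∷ _} (a ∷ as) (b ∷ bs) = distₛ s a b ⊔ maxDist as bs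

  record Modulus : Set where
    field
      Δ        : ℝ → ℝ
      positive : ∀ {ε} → 0# < ε → 0# < Δ ε
  open Modulus public

  record Language : Set₁ where
    field
      Sort      : Set
      Function  : Set
      dom       : Function → List Sort
      cod       : Function → Sort
      modᶠ      : Function → Modulus
      Predicate : Set
      arity     : Predicate → List Sort
      modᵖ      : Predicate → Modulus
      Kᵖ        : Predicate → Pred 𝔙 0ℓ
      compact   : ∀ P → IsCompact (Kᵖ P)

  module _ (L : Language) where

    open Language L

    -- A tuple of variables is represented by its list of sorts.
    Context : Set
    Context = List Sort

    data Term (Γ : Context) : Sort → Set where
      var : ∀ {s} → s ∈ Γ → Term Γ s
      app : (f : Function) → All (Term Γ) (dom f) → Term Γ (cod f)

    data Formula : Context → Set
    K : ∀ {Γ} → Formula Γ → Pred 𝔙 0ℓ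

    -- In `sup x ψ` and `inf x ψ` the tuple x is bound.
    data Formula where
      dist : ∀ {Γ s} → Term Γ s → Term Γ s → Formula Γ
      pred : ∀ {Γ} (P : Predicate) → All (Term Γ) (arity P) → Formula Γ
      conn : ∀ {Γ n} (u : Vector 𝔙 n → 𝔙) → Continuous u →
             Vector (Formula Γ) n → Formula Γ
      sup  : ∀ {Γ} (x : Context) (ψ : Formula (x ++ Γ)) →
             (∀ r → K ψ r → ℝ≥0 r) → Formula Γ
      inf  : ∀ {Γ} (x : Context) (ψ : Formula (x ++ Γ)) →
             (∀ r → K ψ r → ℝ≥0 r) → Formula Γ

    K (dist _ _)   r = ∃ λ t → (0# ≤ t) × (t ≤ 1#) × (r ≈ ι t)
    K (pred P _)   r = Kᵖ P r
    K (conn u _ φ) r = ∃ λ v → (∀ i → K (φ i) (v i)) × (r ≈ u v)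
    K (sup _ ψ _)  r = K ψ r
    K (inf _ ψ _)  r = K ψ r

    record Structure : Set₁ where
      field
        space : Sort → CompleteMetricSpace

      open Product space public

      field
        fun      : ∀ f → Tuple (dom f) → ⟨ cod f ⟩
        fun-cont : ∀ f ε → 0# < ε → ∀ a b → maxDist a b < Δ (modᶠ f) ε →
                   distₛ (cod f) (fun f a) (fun f b) ≤ ε
        rel      : ∀ P → Tuple (arity P) → 𝔙
        rel-K    : ∀ P a → Kᵖ P (rel P a)
        rel-cont : ∀ P ε → 0# < ε → ∀ a b → maxDist a b < Δ (modᵖ P) ε →
                   𝔡 (rel P a) (rel P b) ≤ ε

  module _ {L : Language} where

    module _ (M : Structure L) where

      open Structure M

      evalᵗ  : ∀ {Γ s} → Term L Γ s → Tuple Γ → ⟨ s ⟩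
      evalᵗˢ : ∀ {Γ x} → All (Term L Γ) x → Tuple Γ → Tuple x
      evalᵗ (var i)    a = All.lookup a i
      evalᵗ (app f ts) a = fun f (evalᵗˢ ts a)
      evalᵗˢ []       a = []
      evalᵗˢ (t ∷ ts) a = evalᵗ t a ∷ evalᵗˢ ts a

      -- In the last two clauses the set of reals is inhabited (sorts are
      -- inhabited) and bounded (K ψ is compact).
      eval : ∀ {Γ} → Formula L Γ → Tuple Γ → 𝔙
      eval (dist {s = s} t t′) a = ι (distₛ s (evalᵗ t a) (evalᵗ t′ a))
      eval (pred P ts)         a = rel P (evalᵗˢ ts a)
      eval (conn u _ φ)        a = u (λ i → eval (φ i) a)
      eval (sup x ψ _) a = ι (supremum λ t → ∃ λ (b : Tuple x) → eval ψ (++⁺ b a) ≈ ι t)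
      eval (inf x ψ _) a = ι (infimum  λ t → ∃ λ (b : Tuple x) → eval ψ (++⁺ b a) ≈ ι t)

      eval₂ : ∀ {x y} → Formula L (x ++ y) → Tuple x → Tuple y → 𝔙
      eval₂ φ a b = eval φ (++⁺ a b)

      Stable : ∀ x y → ℝ → Formula L (x ++ y) → Set
      Stable x y ε φ =
        ¬ (Σ (ℕ → Tuple x) λ a → Σ (ℕ → Tuple y) λ b →
           ∀ i j → i ℕ.< j → ε ≤ 𝔡 (eval₂ φ (a i) (b j)) (eval₂ φ (a j) (b i)))

    -- Preservation of `dist` formulas makes the embedding isometric and
    -- compatible with the function symbols.
    record _≼_ (M N : Structure L) : Set where
      private
        module M = Structure M
        module N = Structure N
      field
        embed : ∀ {s} → M.⟨ s ⟩ → N.⟨ s ⟩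

      embedˢ : ∀ {x} → M.Tuple x → N.Tuple x
      embedˢ = All.map embed

      field
        elementary : ∀ {Γ} (ψ : Formula L Γ) (a : M.Tuple Γ) →
                     eval N ψ (embedˢ a) ≈ eval M ψ a

    -- A complete φ(x)-type over M, given by the function b ↦ φ(p,b) on M^y
    -- together with a realization in an elementary extension.
    record φType (M : Structure L) (x y : Context L) (φ : Formula L (x ++ y)) : Set₁ where
      field
        value       : Structure.Tuple M y → 𝔙
        extension   : Structure L
        M≼N         : M ≼ extension
        realization : Structure.Tuple extension x
        realizes    : ∀ b →
          eval₂ extension φ realization (_≼_.embedˢ M≼N b) ≈ value b

{-# OPTIONS --safe #-}
-- If no finite set of points determines p, one builds inductively a_n, b_n, c_n
-- such that φ(a_i,b_n) and φ(a_i,c_n) are δ-close for i < n, φ(p,b_n) and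
-- φ(p,c_n) are at least 2ε + γ apart, and a_n realizes p up to (γ − δ)/2 on all
-- earlier b_i, c_i. For i < j the path
--   φ(p,b_i), φ(a_j,b_i), φ(a_i,b_j), φ(a_i,c_j), φ(a_j,c_i), φ(p,c_i)
-- has total length at least 2ε + γ, so its second or its fourth step is at
-- least ε. By Ramsey's theorem the same one works for all pairs from an
-- infinite set, contradicting stability.

module Submission where

open import Defs
import Algebra.Construct.NaturalChoice.Max as Max
import Algebra.Properties.AbelianGroup as AbelianGroupProperties
import Algebra.Properties.CommutativeSemigroup as CommutativeSemigroupProperties
import Algebra.Solver.Ring.NaturalCoefficients.Default as Solver
open import Axiom.ExcludedMiddle using (ExcludedMiddle)
open import Data.Fin.Base using (Fin; zero; suc)
open import Data.List.Base using (List; []; _∷_; _++_; length; lookup; map)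
open import Data.List.Membership.Propositional using (_∈_)
open import Data.List.Membership.Propositional.Properties using (∈-++⁺ˡ; ∈-++⁺ʳ; ∈-map⁺)
open import Data.List.Relation.Unary.All as All using (All; []; _∷_)
open import Data.List.Relation.Unary.All.Properties using (++⁺; lookup-map)
open import Data.List.Relation.Unary.Any using (here; there)
open import Data.Nat.Base as ℕ using (ℕ; zero; suc)
import Data.Nat.Properties as ℕ
open import Data.Product.Base as Product using (Σ; ∃; _×_; _,_; proj₁; proj₂)
open import Data.Sum.Base as Sum using (_⊎_; inj₁; inj₂; [_,_]; fromInj₁; fromInj₂)
open import Data.Unit.Base using (⊤; tt)
open import Data.Vec.Functional using (Vector; head; tail)
open import Function.Base using (_∘_; id)
open import Level using (0ℓ)
open import Relation.Binary.Bundles using (TotalOrder)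
import Relation.Binary.Construct.NonStrictToStrict as NonStrictToStrict
open import Relation.Binary.Core using (Rel)
open import Relation.Binary.PropositionalEquality as ≡ using (_≡_)
import Relation.Binary.Reasoning.PartialOrder as PartialOrderReasoning
open import Relation.Nullary using (¬_; yes; no; contradiction)
open import Relation.Unary using (Pred)

-- Finite lists and dependent choice.

All-lookup⁺ : ∀ {A : Set} {P : Pred A 0ℓ} (xs : List A) → (∀ i → P (lookup xs i)) → All P xs
All-lookup⁺ []       p = []
All-lookup⁺ (x ∷ xs) p = p zero ∷ All-lookup⁺ xs (p ∘ suc)

-- Each term is chosen against the list of all earlier terms, not only the last one. Membership in
-- `history` then yields the relation for every pair i < j, without transitivity of `Q`.
module DependentChoice {A : Set} (Q : Rel A 0ℓ)
  (next : ∀ h → ∃ λ a → All (λ b → Q b a) h) where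

  history : ℕ → List A
  term    : ℕ → A
  history zero    = []
  history (suc n) = term n ∷ history n
  term n = proj₁ (next (history n))

  term∈history : ∀ {i j} → i ℕ.< j → term i ∈ history j
  term∈history {i} {suc j} i<1+j with ℕ.m<1+n⇒m<n∨m≡n i<1+j
  ... | inj₁ i<j    = there (term∈history i<j)
  ... | inj₂ ≡.refl = here ≡.refl

  related : ∀ i j → i ℕ.< j → Q (term i) (term j)
  related i j i<j = All.lookup (proj₂ (next (history j))) (term∈history i<j)

-- Classical logic and Ramsey's theorem for pairs.

module Classical (em : ∀ {ℓ} → ExcludedMiddle ℓ) where

  ¬∀⇒∃¬ : ∀ {a p} {A : Set a} {P : A → Set p} → ¬ (∀ x → P x) → ∃ λ x → ¬ P x
  ¬∀⇒∃¬ {P = P} ¬∀ with em {P = ∃ λ x → ¬ P x}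
  ... | yes p = p
  ... | no ¬∃ = contradiction all ¬∀
    where
    all : ∀ x → P x
    all x with em {P = P x}
    ... | yes px = px
    ... | no ¬px = contradiction (x , ¬px) ¬∃

  ¬→⇒×¬ : ∀ {a b} {A : Set a} {B : Set b} → ¬ (A → B) → A × ¬ B
  ¬→⇒×¬ = ¬∀⇒∃¬

  Infinite : Pred ℕ 0ℓ → Set
  Infinite S = ∀ n → ∃ λ m → n ℕ.< m × S m

  -- Either every infinite set has an element that is A-related to infinitely
  -- many others, and iterating this gives the first alternative; or some
  -- infinite set S has none, and then any finite subset of S is B-related to
  -- all large elements of S.
  ramsey : (A B : Rel ℕ 0ℓ) → (∀ i j → i ℕ.< j → A i j ⊎ B i j) →
           (∃ λ (g : ℕ → ℕ) → ∀ i j → i ℕ.< j → A (g i) (g j)) ⊎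
           (∃ λ (g : ℕ → ℕ) → ∀ i j → i ℕ.< j → B (g i) (g j))
  ramsey A B A⊎B with em {P = ∀ S → Infinite S →
                             ∃ λ x → S x × Infinite (λ y → S y × A x y)}
  ... | yes good = inj₁ (pick , pick-related)
    where
    choose : ((S , inf) : Σ (Pred ℕ 0ℓ) Infinite) →
             ∃ λ x → S x × Infinite (λ y → S y × A x y)
    choose (S , inf) = good S inf

    -- A decreasing chain of infinite sets: stage n + 1 keeps only points that the n-th pick is
    -- A-related to, so each later pick is automatically related to all earlier ones.
    sets : ℕ → Σ (Pred ℕ 0ℓ) Infinite
    sets zero    = (λ _ → ⊤) , λ n → suc n , ℕ.n<1+n n , tt
    sets (suc n) = let x , _ , inf = choose (sets n) in
                   (λ y → proj₁ (sets n) y × A x y) , inf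

    pick : ℕ → ℕ
    pick n = proj₁ (choose (sets n))

    pick∈ : ∀ n → proj₁ (sets n) (pick n)
    pick∈ n = proj₁ (proj₂ (choose (sets n)))

    sets⇒related : ∀ i j {y} → i ℕ.< j → proj₁ (sets j) y → A (pick i) y
    sets⇒related i (suc j) i<1+j (y∈ , Ay) with ℕ.m<1+n⇒m<n∨m≡n i<1+j
    ... | inj₁ i<j    = sets⇒related i j i<j y∈
    ... | inj₂ ≡.refl = Ay

    pick-related : ∀ i j → i ℕ.< j → A (pick i) (pick j)
    pick-related i j i<j = sets⇒related i j i<j (pick∈ j)
  ... | no ¬good with ¬∀⇒∃¬ ¬good
  ... | S , ¬goodS with ¬→⇒×¬ ¬goodS
  ... | infinite , ¬∃ = inj₂ (proj₁ ∘ term , related)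
    where
    bounded : ∀ x → S x → ∃ λ n → ∀ m → n ℕ.< m → S m → ¬ A x m
    bounded x x∈S with ¬∀⇒∃¬ (λ inf → ¬∃ (x , x∈S , inf))
    ... | n , ¬inf = n , λ m n<m m∈S Axm → ¬inf (m , n<m , m∈S , Axm)

    Beyond : ℕ → ∃ S → Set
    Beyond n (x , _) = ∀ m → n ℕ.< m → S m → B x m

    beyond-mono : ∀ {k n} → k ℕ.≤ n → ∀ {x} → Beyond k x → Beyond n x
    beyond-mono k≤n Bx m n<m = Bx m (ℕ.≤-<-trans k≤n n<m)

    eventually : ∀ x → ∃ λ n → Beyond n x
    eventually (x , x∈S) with bounded x x∈S
    -- The bound x + k does two jobs: beyond k the relation `A x m` fails, and beyond x the
    -- dichotomy `A⊎B` applies.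
    ... | k , ¬A = x ℕ.+ k , λ m x+k<m m∈S →
      fromInj₂ (λ Axm → contradiction Axm (¬A m (ℕ.≤-<-trans (ℕ.m≤n+m k x) x+k<m) m∈S))
               (A⊎B x m (ℕ.≤-<-trans (ℕ.m≤m+n x k) x+k<m))

    threshold : ∀ h → ∃ λ n → All (Beyond n) h
    threshold [] = 0 , []
    threshold (x ∷ h) with eventually x | threshold h
    ... | k , Bx | n , Bh = k ℕ.+ n ,
      beyond-mono (ℕ.m≤m+n k n) {x} Bx ∷ All.map (λ {z} → beyond-mono (ℕ.m≤n+m n k) {z}) Bh

    next : (h : List (∃ S)) → ∃ λ y → All (λ x → B (proj₁ x) (proj₁ y)) h
    next h with threshold h
    ... | n , Bh with infinite n
    ... | m , n<m , m∈S = (m , m∈S) , All.map {P = Beyond n} (λ Bx → Bx m n<m m∈S) Bh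

    open DependentChoice (λ x y → B (proj₁ x) (proj₁ y)) next

  -- Dependent choice first builds a sequence in which each pair satisfies `P` or `Q`; Ramsey's
  -- theorem on its indices then selects one of the two.
  homogeneous-sequence : {A : Set} (P Q : Rel A 0ℓ) →
    (∀ h → ∃ λ a → All (λ b → P b a ⊎ Q b a) h) →
    (∃ λ (s : ℕ → A) → ∀ i j → i ℕ.< j → P (s i) (s j)) ⊎
    (∃ λ (s : ℕ → A) → ∀ i j → i ℕ.< j → Q (s i) (s j))
  homogeneous-sequence P Q next = Sum.map (Product.map (term ∘_) id) (Product.map (term ∘_) id)
    (ramsey (λ i j → P (term i) (term j)) (λ i j → Q (term i) (term j)) related)
    where open DependentChoice (λ b a → P b a ⊎ Q b a) next

-- Arithmetic and order in a complete ordered field.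

module Reals (em : ∀ {ℓ} → ExcludedMiddle ℓ) (R : CompleteOrderedField) where

  open CompleteOrderedField R
  open AbelianGroupProperties +-abelianGroup
    using (⁻¹-anti-homo‿-; xyx⁻¹≈y; x≈y⇒x∙y⁻¹≈ε; ∙-cancelʳ)
  open CommutativeSemigroupProperties +-commutativeSemigroup using (interchange)
  open Max totalOrder using (⊔-lub; ⊔-sel; x≤x⊔y; x≤y⊔x)
  open Solver commutativeSemiring using (solve; _:+_; _:*_; _:=_; con)
  private module Strict = NonStrictToStrict _≈_ _≤_
  module ≤-Reasoning = PartialOrderReasoning (TotalOrder.poset totalOrder)
  open ≤-Reasoning

  ≰⇒> : ∀ {x y} → ¬ x ≤ y → y < x
  ≰⇒> = Strict.≰⇒> sym ≤-reflexive total

  <⇒≱ : ∀ {x y} → x < y → ¬ y ≤ x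
  <⇒≱ = Strict.<⇒≱ antisym

  ≤⊎> : ∀ x y → x ≤ y ⊎ y < x
  ≤⊎> x y with em {P = x ≤ y}
  ... | yes x≤y = inj₁ x≤y
  ... | no  x≰y = inj₂ (≰⇒> x≰y)

  +-mono-≤ : ∀ {a b c d} → a ≤ b → c ≤ d → a + c ≤ b + d
  +-mono-≤ {a} {b} {c} {d} a≤b c≤d = begin
    a + c ≤⟨ +-monoˡ-≤ c a≤b ⟩
    b + c ≈⟨ +-comm b c ⟩
    c + b ≤⟨ +-monoˡ-≤ b c≤d ⟩
    d + b ≈⟨ +-comm d b ⟩
    b + d ∎

  +-monoˡ-< : ∀ c {a b} → a < b → a + c < b + c
  +-monoˡ-< c {a} {b} (a≤b , a≉b) = +-monoˡ-≤ c a≤b , a≉b ∘ ∙-cancelʳ c a b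

  +-mono-<-≤ : ∀ {a b c d} → a < b → c ≤ d → a + c < b + d
  +-mono-<-≤ {a} {b} {c} {d} a<b c≤d = begin-strict
    a + c <⟨ +-monoˡ-< c a<b ⟩
    b + c ≤⟨ +-mono-≤ ≤-refl c≤d ⟩
    b + d ∎

  +-mono-< : ∀ {a b c d} → a < b → c < d → a + c < b + d
  +-mono-< a<b c<d = +-mono-<-≤ a<b (proj₁ c<d)

  x<y+z⇒x-y<z : ∀ {x y z} → x < y + z → x - y < z
  x<y+z⇒x-y<z {x} {y} {z} x<y+z = begin-strict
    x - y     <⟨ +-monoˡ-< (- y) x<y+z ⟩
    y + z - y ≈⟨ xyx⁻¹≈y y z ⟩
    z         ∎

  x<y⇒0<y-x : ∀ {x y} → x < y → 0# < y - x
  x<y⇒0<y-x {x} {y} x<y = begin-strict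
    0#    ≈⟨ -‿inverseʳ x ⟨
    x - x <⟨ +-monoˡ-< (- x) x<y ⟩
    y - x ∎

  x+[y-x]≈y : ∀ x y → x + (y - x) ≈ y
  x+[y-x]≈y x y = trans (sym (+-assoc x y (- x))) (xyx⁻¹≈y x y)

  [x-y]+[y-z]≈x-z : ∀ x y z → (x - y) + (y - z) ≈ x - z
  [x-y]+[y-z]≈x-z x y z = begin-equality
    (x - y) + (y - z)   ≈⟨ interchange x (- y) y (- z) ⟩
    (x + y) + (- y - z) ≈⟨ +-assoc (x + y) (- y) (- z) ⟨
    (x + y) - y - z     ≈⟨ +-congʳ (trans (+-assoc x y (- y)) (trans (+-congˡ (-‿inverseʳ y)) (+-identityʳ x))) ⟩
    x - z               ∎

  -- Regroups the bounds for the five steps of the path, so that η + η can be replaced by γ - δ.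
  rearrange : ∀ η ε δ → η + (ε + (δ + (ε + η))) ≈ (1# + 1#) * ε + (δ + (η + η))
  rearrange = solve 3
    (λ η ε δ → η :+ (ε :+ (δ :+ (ε :+ η))) := (con 1 :+ con 1) :* ε :+ (δ :+ (η :+ η))) refl

  x≤0⇒x+x≤0 : ∀ {x} → x ≤ 0# → x + x ≤ 0#
  x≤0⇒x+x≤0 x≤0 = ≤-respʳ-≈ (+-identityˡ 0#) (+-mono-≤ x≤0 x≤0)

  -- 0 and 1 are comparable; if 1 + 1 were 0, adding 1 to the comparison would give the reverse one,
  -- and so 0 = 1.
  1+1≉0 : ¬ (1# + 1# ≈ 0#)
  1+1≉0 2≈0 with total 0# 1#
  ... | inj₁ 0≤1 = 0≉1 (antisym 0≤1 (begin
    1#      ≈⟨ +-identityˡ 1# ⟨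
    0# + 1# ≤⟨ +-monoˡ-≤ 1# 0≤1 ⟩
    1# + 1# ≈⟨ 2≈0 ⟩
    0#      ∎))
  ... | inj₂ 1≤0 = 0≉1 (antisym (begin
    0#      ≈⟨ 2≈0 ⟨
    1# + 1# ≤⟨ +-monoˡ-≤ 1# 1≤0 ⟩
    0# + 1# ≈⟨ +-identityˡ 1# ⟩
    1#      ∎) 1≤0)

  half : ∀ {x} → 0# < x → ∃ λ h → 0# < h × h + h ≈ x
  half {x} 0<x with inverse (1# + 1#) 1+1≉0
  ... | i , 2i≈1 = h , ≰⇒> h≰0 , h+h≈x
    where
    h = i * x

    h+h≈x : h + h ≈ x
    h+h≈x = begin-equality
      i * x + i * x             ≈⟨ +-cong (*-identityˡ h) (*-identityˡ h) ⟨
      1# * (i * x) + 1# * (i * x) ≈⟨ distribʳ h 1# 1# ⟨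
      (1# + 1#) * (i * x)       ≈⟨ *-assoc _ i x ⟨
      (1# + 1#) * i * x         ≈⟨ *-congʳ 2i≈1 ⟩
      1# * x                    ≈⟨ *-identityˡ x ⟩
      x                         ∎

    h≰0 : ¬ h ≤ 0#
    h≰0 h≤0 = <⇒≱ 0<x (≤-respˡ-≈ h+h≈x (x≤0⇒x+x≤0 h≤0))

  ⊔-lub-< : ∀ {x y z} → x < z → y < z → x ⊔ y < z
  ⊔-lub-< {x} {y} {z} x<z y<z with ⊔-sel x y
  ... | inj₁ eq = begin-strict x ⊔ y ≈⟨ eq ⟩ x <⟨ x<z ⟩ z ∎
  ... | inj₂ eq = begin-strict x ⊔ y ≈⟨ eq ⟩ y <⟨ y<z ⟩ z ∎

  x-y≤∣x-y∣ : ∀ x y → x - y ≤ ∣ x - y ∣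
  x-y≤∣x-y∣ x y = x≤x⊔y _ _

  y-x≤∣x-y∣ : ∀ x y → y - x ≤ ∣ x - y ∣
  y-x≤∣x-y∣ x y = ≤-respˡ-≈ (⁻¹-anti-homo‿- x y) (x≤y⊔x _ _)

  ∣x-y∣≤ : ∀ {x y z} → x - y ≤ z → y - x ≤ z → ∣ x - y ∣ ≤ z
  ∣x-y∣≤ {x} {y} p q = ⊔-lub p (≤-respˡ-≈ (sym (⁻¹-anti-homo‿- x y)) q)

  ∣x-y∣< : ∀ {x y z} → x < y + z → y < x + z → ∣ x - y ∣ < z
  ∣x-y∣< {x} {y} p q = ⊔-lub-< (x<y+z⇒x-y<z p)
    (Strict.<-respˡ-≈ trans ≤-respˡ-≈ (sym (⁻¹-anti-homo‿- x y)) (x<y+z⇒x-y<z q))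

  0≤∣x∣ : ∀ x → 0# ≤ ∣ x ∣
  0≤∣x∣ x with total 0# x
  ... | inj₁ 0≤x = ≤-trans 0≤x (x≤x⊔y _ _)
  ... | inj₂ x≤0 = begin
    0#    ≈⟨ -‿inverseʳ x ⟨
    x - x ≤⟨ +-monoˡ-≤ (- x) x≤0 ⟩
    0# - x ≈⟨ +-identityˡ (- x) ⟩
    - x   ≤⟨ x≤y⊔x _ _ ⟩
    ∣ x ∣ ∎

  x≈y⇒∣x-y∣≤0 : ∀ {x y} → x ≈ y → ∣ x - y ∣ ≤ 0#
  x≈y⇒∣x-y∣≤0 x≈y = ∣x-y∣≤ (≤-reflexive (x≈y⇒x∙y⁻¹≈ε x≈y))
                           (≤-reflexive (x≈y⇒x∙y⁻¹≈ε (sym x≈y)))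

  x-y≤0⇒x≤y : ∀ {x y} → x - y ≤ 0# → x ≤ y
  x-y≤0⇒x≤y {x} {y} x-y≤0 = begin
    x           ≈⟨ x+[y-x]≈y y x ⟨
    y + (x - y) ≤⟨ +-mono-≤ ≤-refl x-y≤0 ⟩
    y + 0#      ≈⟨ +-identityʳ y ⟩
    y           ∎

  ∣x-y∣≤0⇒x≈y : ∀ {x y} → ∣ x - y ∣ ≤ 0# → x ≈ y
  ∣x-y∣≤0⇒x≈y {x} {y} p = antisym
    (x-y≤0⇒x≤y (≤-trans (x-y≤∣x-y∣ x y) p))
    (x-y≤0⇒x≤y (≤-trans (y-x≤∣x-y∣ x y) p))

  ≤0-if-<pos : ∀ {x} → (∀ ε → 0# < ε → x < ε) → x ≤ 0#
  ≤0-if-<pos {x} x< with ≤⊎> x 0#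
  ... | inj₁ x≤0 = x≤0
  ... | inj₂ 0<x = contradiction ≤-refl (<⇒≱ (x< x 0<x))

-- The ladder argument, free of logic.

module FiniteDetermination (em : ∀ {ℓ} → ExcludedMiddle ℓ) (R : CompleteOrderedField) where

  open CompleteOrderedField R hiding (zero)
  open Reals em R

  -- Here `F` stands for φ on M and `value` for b ↦ φ(p,b). The assumption `approximate`, that p is
  -- finitely realized in M up to any error, is the only place where logic enters.
  module _ {V : Set} (d : V → V → Carrier)
    (d-sym : ∀ r s → d r s ≤ d s r) (d-triangle : ∀ r s t → d r t ≤ d r s + d s t)
    {X Y : Set} (F : X → Y → V) (value : Y → V)
    (approximate : ∀ {n} (e : Fin n → Y) {η} → 0# < η →
                   ∃ λ a → ∀ k → d (F a (e k)) (value (e k)) < η)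
    where
    open ≤-Reasoning

    NoLadder : Carrier → Set
    NoLadder ε = ¬ (Σ (ℕ → X) λ a → Σ (ℕ → Y) λ b →
                    ∀ i j → i ℕ.< j → ε ≤ d (F (a i) (b j)) (F (a j) (b i)))

    -- The first two steps are reversed to fit their later use: `Approximates` puts `F a b` before
    -- `value b`, and `NoLadder` puts the earlier row first.
    d-path : ∀ r s t u → d r u ≤ d s r + (d t s + d t u)
    d-path r s t u = begin
      d r u                     ≤⟨ d-triangle r s u ⟩
      d r s + d s u             ≤⟨ +-mono-≤ (d-sym r s) (d-triangle s t u) ⟩
      d s r + (d s t + d t u)   ≤⟨ +-mono-≤ ≤-refl (+-monoˡ-≤ (d t u) (d-sym s t)) ⟩
      d s r + (d t s + d t u)   ∎

    -- If both undecided steps were shorter than ε, the path would be shorter than η + ε + δ + ε +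
    -- η, which equals 2ε + γ because η is half of γ - δ.
    long-step : ∀ {ε γ δ η} r s t u v w → η + η ≈ γ - δ →
      d s r < η → d t u < δ → d v w < η → (1# + 1#) * ε + γ ≤ d r w →
      ε ≤ d t s ⊎ ε ≤ d u v
    long-step {ε} {γ} {δ} {η} r s t u v w 2η≈γ-δ sr<η tu<δ vw<η far
      with ≤⊎> ε (d t s) | ≤⊎> ε (d u v)
    ... | inj₁ ε≤ts | _         = inj₁ ε≤ts
    ... | inj₂ _    | inj₁ ε≤uv = inj₂ ε≤uv
    ... | inj₂ ts<ε | inj₂ uv<ε = contradiction far (<⇒≱ (begin-strict
      d r w
        ≤⟨ d-path r s t w ⟩
      d s r + (d t s + d t w)
        ≤⟨ +-mono-≤ ≤-refl (+-mono-≤ ≤-refl (d-triangle t u w)) ⟩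
      d s r + (d t s + (d t u + d u w))
        ≤⟨ +-mono-≤ ≤-refl (+-mono-≤ ≤-refl (+-mono-≤ ≤-refl (d-triangle u v w))) ⟩
      d s r + (d t s + (d t u + (d u v + d v w)))
        <⟨ +-mono-< sr<η (+-mono-< ts<ε (+-mono-< tu<δ (+-mono-< uv<ε vw<η))) ⟩
      η + (ε + (δ + (ε + η)))
        ≈⟨ rearrange η ε δ ⟩
      (1# + 1#) * ε + (δ + (η + η))
        ≈⟨ +-congˡ (trans (+-congˡ 2η≈γ-δ) (x+[y-x]≈y δ γ)) ⟩
      (1# + 1#) * ε + γ
        ∎))

    finitely-determined : ∀ {ε} → NoLadder ε → ∀ {γ δ} → δ < γ →
      ∃ λ h → ∀ b c → All (λ a → d (F a b) (F a c) < δ) h →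
              d (value b) (value c) < (1# + 1#) * ε + γ
    finitely-determined {ε} stable {γ} {δ} δ<γ
      with em {P = ∃ λ h → ∀ b c → All (λ a → d (F a b) (F a c) < δ) h →
                           d (value b) (value c) < (1# + 1#) * ε + γ}
    ... | yes determined = determined
    -- The slack γ - δ is split evenly between the two ends of the path, where p is replaced by a
    -- point of M.
    ... | no ∄ with half (x<y⇒0<y-x δ<γ)
    ...   | η , 0<η , 2η≈γ-δ = contradiction unstable stable
      where
      open Classical em

      Far : Y → Y → Set
      Far b c = (1# + 1#) * ε + γ ≤ d (value b) (value c)

      -- Only the condition internal to one stage is stored. Closeness and approximation relate two
      -- stages, and `next` consumes them at once.
      record Triple : Set where
        field
          a   : X
          b c : Y
          far : Far b c
      open Triple

      -- With `f` equal to `b` or to `c`, these are the two colours for Ramsey's theorem.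
      Unstable : (Triple → Y) → Rel Triple 0ℓ
      Unstable f t t′ = ε ≤ d (F (a t) (f t′)) (F (a t′) (f t))

      Near : Y → Y → X → Set
      Near b c a = d (F a b) (F a c) < δ

      Approximates : X → Y → Set
      Approximates a b = d (F a b) (value b) < η

      undetermined : ∀ h → ∃ λ b → ∃ λ c → Far b c × All (Near b c) h
      undetermined h with em {P = ∃ λ b → ∃ λ c → Far b c × All (Near b c) h}
      ... | yes pair  = pair
      -- Without such a pair, `h` itself would be a determining list, against `∄`.
      ... | no ∄pair = contradiction (h , λ b c near →
        fromInj₂ (λ far → contradiction (b , c , far , near) ∄pair)
                 (≤⊎> ((1# + 1#) * ε + γ) (d (value b) (value c)))) ∄

      realizer : ∀ es → ∃ λ a → All (Approximates a) es
      realizer es =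
        let a , approx = approximate (lookup es) 0<η in a , All-lookup⁺ es approx

      successor : ∀ {t t′} → Near (b t′) (c t′) (a t) →
                  Approximates (a t′) (b t) → Approximates (a t′) (c t) →
                  Unstable b t t′ ⊎ Unstable c t t′
      successor {t} {t′} near near-b near-c = long-step
        (value (b t)) (F (a t′) (b t)) (F (a t) (b t′))
        (F (a t) (c t′)) (F (a t′) (c t)) (value (c t))
        2η≈γ-δ near-b near near-c (far t)

      next : ∀ h → ∃ λ t′ → All (λ t → Unstable b t t′ ⊎ Unstable c t t′) h
      next h = t′ , All.tabulate λ {t} t∈h → successor {t} {t′}
          (All.lookup near (∈-map⁺ a t∈h))
          (All.lookup approx (∈-++⁺ˡ (∈-map⁺ b t∈h)))
          (All.lookup approx (∈-++⁺ʳ (map b h) (∈-map⁺ c t∈h)))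
        where
        -- The new `b` and `c` are chosen against the earlier `a`s, and the new `a` against the
        -- earlier `b`s and `c`s; neither choice depends on the other.
        pair = undetermined (map a h)
        b′ = proj₁ pair
        c′ = proj₁ (proj₂ pair)
        near = proj₂ (proj₂ (proj₂ pair))
        approx-a = realizer (map b h ++ map c h)
        approx = proj₂ approx-a

        t′ : Triple
        t′ = record { a = proj₁ approx-a ; b = b′ ; c = c′ ; far = proj₁ (proj₂ (proj₂ pair)) }

      unstable : Σ (ℕ → X) λ a → Σ (ℕ → Y) λ b → ∀ i j → i ℕ.< j →
                 ε ≤ d (F (a i) (b j)) (F (a j) (b i))
      unstable = [ (λ (s , unstable-b) → a ∘ s , b ∘ s , unstable-b)
                 , (λ (s , unstable-c) → a ∘ s , c ∘ s , unstable-c)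
                 ] (homogeneous-sequence (Unstable b) (Unstable c) next)

-- The supremum metric on 𝔙 and the maximum distance on its finite powers.

module Distance (em : ∀ {ℓ} → ExcludedMiddle ℓ) (R : CompleteOrderedField) where

  open CompleteOrderedField R renaming (Carrier to ℝ; _≈_ to _≈ᵣ_; _-_ to _-ᵣ_)
    hiding (refl; sym; trans; zero)
  private module ℝ = CompleteOrderedField R
  open Values R
  open Reals em R
  open Max totalOrder using (⊔-lub; x≤x⊔y; x≤y⊔x)
  open ≤-Reasoning

  ∣seq-seq∣≤𝔡 : ∀ r s n → ∣ seq r n -ᵣ seq s n ∣ ≤ 𝔡 r s
  ∣seq-seq∣≤𝔡 r s n = proj₁ (‖‖-isLub (r - s)) _ (n , ℝ.refl)

  𝔡-lub : ∀ r s {b} → (∀ n → ∣ seq r n -ᵣ seq s n ∣ ≤ b) → 𝔡 r s ≤ b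
  𝔡-lub r s p = proj₂ (‖‖-isLub (r - s)) _ λ { _ (n , t≈) → ≤-respˡ-≈ (ℝ.sym t≈) (p n) }

  0≤𝔡 : ∀ r s → 0# ≤ 𝔡 r s
  0≤𝔡 r s = ≤-trans (0≤∣x∣ _) (∣seq-seq∣≤𝔡 r s 0)

  𝔡-sym : ∀ r s → 𝔡 r s ≤ 𝔡 s r
  𝔡-sym r s = 𝔡-lub r s λ n → ≤-trans
    (∣x-y∣≤ (y-x≤∣x-y∣ _ _) (x-y≤∣x-y∣ _ _)) (∣seq-seq∣≤𝔡 s r n)

  𝔡-triangle : ∀ r s t → 𝔡 r t ≤ 𝔡 r s + 𝔡 s t
  𝔡-triangle r s t = 𝔡-lub r t λ n → ∣x-y∣≤
    (≤-respˡ-≈ ([x-y]+[y-z]≈x-z _ _ _) (+-mono-≤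
      (≤-trans (x-y≤∣x-y∣ _ _) (∣seq-seq∣≤𝔡 r s n))
      (≤-trans (x-y≤∣x-y∣ _ _) (∣seq-seq∣≤𝔡 s t n))))
    (≤-respʳ-≈ (+-comm _ _) (≤-respˡ-≈ ([x-y]+[y-z]≈x-z _ _ _) (+-mono-≤
      (≤-trans (y-x≤∣x-y∣ _ _) (∣seq-seq∣≤𝔡 s t n))
      (≤-trans (y-x≤∣x-y∣ _ _) (∣seq-seq∣≤𝔡 r s n)))))

  ≈⇒𝔡≤0 : ∀ {r s} → r ≈ s → 𝔡 r s ≤ 0#
  ≈⇒𝔡≤0 {r} {s} r≈s = 𝔡-lub r s λ n → x≈y⇒∣x-y∣≤0 (r≈s n)

  𝔡≤0⇒≈ : ∀ {r s} → 𝔡 r s ≤ 0# → r ≈ s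
  𝔡≤0⇒≈ {r} {s} p n = ∣x-y∣≤0⇒x≈y (≤-trans (∣seq-seq∣≤𝔡 r s n) p)

  𝔡-≈ˡ : ∀ {r s t} → r ≈ s → 𝔡 r t ≤ 𝔡 s t
  𝔡-≈ˡ {r} {s} {t} r≈s = begin
    𝔡 r t         ≤⟨ 𝔡-triangle r s t ⟩
    𝔡 r s + 𝔡 s t ≤⟨ +-monoˡ-≤ _ (≈⇒𝔡≤0 r≈s) ⟩
    0# + 𝔡 s t    ≈⟨ +-identityˡ _ ⟩
    𝔡 s t         ∎

  ≈-reflexive : ∀ {r s} → r ≡ s → r ≈ s
  ≈-reflexive ≡.refl n = ℝ.refl

  -- Equal arguments lie within every δ of each other, so their images lie within every ε and are at
  -- distance 0.
  continuous⇒cong : ∀ {n} {u : Vector 𝔙 n → 𝔙} → Continuous u →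
                    ∀ {v w} → (∀ i → v i ≈ w i) → u v ≈ u w
  continuous⇒cong u-cont {v} {w} v≈w = 𝔡≤0⇒≈ (≤0-if-<pos λ ε 0<ε →
    let δ , 0<δ , close = u-cont v ε 0<ε in
    close w λ i → begin-strict 𝔡 (v i) (w i) ≤⟨ ≈⇒𝔡≤0 (v≈w i) ⟩ 0# <⟨ 0<δ ⟩ δ ∎)

  -- The first argument is a fixed target and the second varies. The value 0 at the empty vector is
  -- neutral for `⊔`, since distances are nonnegative.
  maxDistance : ∀ {n} → Vector 𝔙 n → Vector 𝔙 n → ℝ
  maxDistance {zero}  r v = 0#
  maxDistance {suc n} r v = 𝔡 (head v) (head r) ⊔ maxDistance (tail r) (tail v)

  0≤maxDistance : ∀ {n} (r v : Vector 𝔙 n) → 0# ≤ maxDistance r v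
  0≤maxDistance {zero}  r v = ≤-refl
  0≤maxDistance {suc n} r v = ≤-trans (0≤𝔡 _ _) (x≤x⊔y _ _)

  𝔡≤maxDistance : ∀ {n} (r v : Vector 𝔙 n) i → 𝔡 (v i) (r i) ≤ maxDistance r v
  𝔡≤maxDistance r v zero    = x≤x⊔y _ _
  𝔡≤maxDistance r v (suc i) = ≤-trans (𝔡≤maxDistance (tail r) (tail v) i) (x≤y⊔x _ _)

  ≈⇒maxDistance≤0 : ∀ {n} (r v : Vector 𝔙 n) → (∀ i → v i ≈ r i) → maxDistance r v ≤ 0#
  ≈⇒maxDistance≤0 {zero}  r v v≈r = ≤-refl
  ≈⇒maxDistance≤0 {suc n} r v v≈r =
    ⊔-lub (≈⇒𝔡≤0 (v≈r zero)) (≈⇒maxDistance≤0 (tail r) (tail v) (v≈r ∘ suc))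

  -- One side of the 1-Lipschitz estimate, by the triangle inequality in each coordinate. Positivity
  -- of ε settles the empty vector, where `near` says nothing.
  maxDistance-near : ∀ {n} {r v w : Vector 𝔙 n} {ε} → 0# < ε →
    (∀ i → 𝔡 (w i) (v i) < ε) → maxDistance r w < maxDistance r v + ε
  maxDistance-near {zero}  {ε = ε} 0<ε near = begin-strict
    0#     <⟨ 0<ε ⟩
    ε      ≈⟨ +-identityˡ ε ⟨
    0# + ε ∎
  maxDistance-near {suc n} {r} {v} {w} {ε} 0<ε near = ⊔-lub-<
    (begin-strict
      𝔡 (head w) (head r)                       ≤⟨ 𝔡-triangle _ (head v) _ ⟩
      𝔡 (head w) (head v) + 𝔡 (head v) (head r) <⟨ +-mono-<-≤ (near zero) (x≤x⊔y _ _) ⟩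
      ε + maxDistance r v                       ≈⟨ +-comm _ _ ⟩
      maxDistance r v + ε                       ∎)
    (begin-strict
      maxDistance (tail r) (tail w)     <⟨ maxDistance-near 0<ε (near ∘ suc) ⟩
      maxDistance (tail r) (tail v) + ε ≤⟨ +-monoˡ-≤ ε (x≤y⊔x _ _) ⟩
      maxDistance r v + ε               ∎)

-- Suprema, infima and the distance connective.

module Logic (em : ∀ {ℓ} → ExcludedMiddle ℓ) (R : CompleteOrderedField)
             (E : Values.IsometricCopy R) where

  open ContinuousLogic em R E
  open Distance em R
  open Reals em R using
    ( <⇒≱; ≤⊎>; ∣x-y∣≤0⇒x≈y; x≈y⇒∣x-y∣≤0; ∣x-y∣<
    ; half; x<y⇒0<y-x; module ≤-Reasoning )
  private module ℝ = CompleteOrderedField R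

  ι-cong : ∀ {s t} → s ≈ᵣ t → ι s ≈ ι t
  ι-cong s≈t = 𝔡≤0⇒≈ (ℝ.≤-respˡ-≈ (ℝ.sym (isometry _ _)) (x≈y⇒∣x-y∣≤0 s≈t))

  ι-injective : ∀ {s t} → ι s ≈ ι t → s ≈ᵣ t
  ι-injective ιs≈ιt = ∣x-y∣≤0⇒x≈y (ℝ.≤-respˡ-≈ (isometry _ _) (≈⇒𝔡≤0 ιs≈ιt))

  lub-unique : ∀ {P s t} → IsLub _≤_ P s → IsLub _≤_ P t → s ≈ᵣ t
  lub-unique (s≥ , s-least) (t≥ , t-least) = ℝ.antisym (s-least _ t≥) (t-least _ s≥)

  glb-unique : ∀ {P s t} → IsGlb _≤_ P s → IsGlb _≤_ P t → s ≈ᵣ t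
  glb-unique (s≤ , s-greatest) (t≤ , t-greatest) = ℝ.antisym (t-greatest _ s≤) (s-greatest _ t≤)

  IsLub-resp : ∀ {P Q : Pred ℝ 0ℓ} {s} → (∀ t → P t → Q t) → (∀ t → Q t → P t) →
               IsLub _≤_ P s → IsLub _≤_ Q s
  IsLub-resp P⊆Q Q⊆P (ub , least) =
    (λ t Qt → ub t (Q⊆P t Qt)) , λ b ub′ → least b λ t Pt → ub′ t (P⊆Q t Pt)

  IsGlb-resp : ∀ {P Q : Pred ℝ 0ℓ} {s} → (∀ t → P t → Q t) → (∀ t → Q t → P t) →
               IsGlb _≤_ P s → IsGlb _≤_ Q s
  IsGlb-resp P⊆Q Q⊆P (lb , greatest) =
    (λ t Qt → lb t (Q⊆P t Qt)) , λ b lb′ → greatest b λ t Pt → lb′ t (P⊆Q t Pt)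

  -- Both sides branch on the existence of a least upper bound. The two decisions agree, and if
  -- neither bound exists both sides take the default 0.
  supremum-cong : ∀ {P Q} → (∀ t → P t → Q t) → (∀ t → Q t → P t) → supremum P ≈ᵣ supremum Q
  supremum-cong {P} {Q} P⊆Q Q⊆P with em {P = ∃ (IsLub _≤_ P)} | em {P = ∃ (IsLub _≤_ Q)}
  ... | yes (_ , lub) | yes (_ , lub′) = lub-unique (IsLub-resp P⊆Q Q⊆P lub) lub′
  ... | yes (s , lub) | no ∄           = contradiction (s , IsLub-resp P⊆Q Q⊆P lub) ∄
  ... | no ∄          | yes (s , lub)  = contradiction (s , IsLub-resp Q⊆P P⊆Q lub) ∄
  ... | no _          | no _           = ℝ.refl

  infimum-cong : ∀ {P Q} → (∀ t → P t → Q t) → (∀ t → Q t → P t) → infimum P ≈ᵣ infimum Q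
  infimum-cong {P} {Q} P⊆Q Q⊆P with em {P = ∃ (IsGlb _≤_ P)} | em {P = ∃ (IsGlb _≤_ Q)}
  ... | yes (_ , glb) | yes (_ , glb′) = glb-unique (IsGlb-resp P⊆Q Q⊆P glb) glb′
  ... | yes (s , glb) | no ∄           = contradiction (s , IsGlb-resp P⊆Q Q⊆P glb) ∄
  ... | no ∄          | yes (s , glb)  = contradiction (s , IsGlb-resp Q⊆P P⊆Q glb) ∄
  ... | no _          | no _           = ℝ.refl

  -- Completeness speaks of least upper bounds; the one of the set of lower bounds is the greatest
  -- lower bound, so the default branch is excluded.
  infimum-isGlb : ∀ {P} → ∃ P → ∃ (LowerBound _≤_ P) → IsGlb _≤_ P (infimum P)
  infimum-isGlb {P} (p , Pp) (b , b≤) with em {P = ∃ (IsGlb _≤_ P)}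
  ... | yes (_ , glb) = glb
  ... | no ∄ with ℝ.complete (LowerBound _≤_ P) (b , b≤) (p , λ x x≤ → x≤ p Pp)
  ...   | s , s-ub , s-least =
    contradiction (s , (λ x Px → s-least x λ c c≤ → c≤ x Px) , s-ub) ∄

  glb-near : ∀ {P s η} → IsGlb _≤_ P s → s < η → ∃ λ t → P t × t < η
  glb-near {P} {s} {η} (_ , greatest) s<η with em {P = ∃ λ t → P t × t < η}
  ... | yes near = near
  ... | no ∄ = contradiction (greatest η η-lowerBound) (<⇒≱ s<η)
    where
    η-lowerBound : LowerBound _≤_ P η
    η-lowerBound t Pt = fromInj₁ (λ t<η → contradiction (t , Pt , t<η) ∄) (≤⊎> η t)

  -- The target values are built into the connective, so a formula of `L` can measure the distance
  -- to prescribed elements of 𝔙; its real, nonnegative values permit `inf`.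
  distanceTo : ∀ {n} → Vector 𝔙 n → Vector 𝔙 n → 𝔙
  distanceTo r v = ι (maxDistance r v)

  distanceTo-continuous : ∀ {n} (r : Vector 𝔙 n) → Continuous (distanceTo r)
  -- δ = ε suffices, because `maxDistance r` is 1-Lipschitz and `ι` is an isometry.
  distanceTo-continuous r v ε 0<ε = ε , 0<ε , λ w near → begin-strict
    𝔡 (distanceTo r v) (distanceTo r w)       ≈⟨ isometry _ _ ⟩
    ∣ maxDistance r v ℝ.- maxDistance r w ∣ <⟨ ∣x-y∣<
      (maxDistance-near {r = r} 0<ε near)
      (maxDistance-near {r = r} 0<ε λ i → begin-strict
        𝔡 (w i) (v i) ≤⟨ 𝔡-sym (w i) (v i) ⟩
        𝔡 (v i) (w i) <⟨ near i ⟩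
        ε ∎) ⟩
    ε ∎
    where open ≤-Reasoning

  -- Renaming of variables.

  Renaming : ∀ {S : Set} → List S → List S → Set
  Renaming Δ Γ = ∀ {s} → s ∈ Δ → s ∈ Γ

  lift : ∀ {S : Set} {Δ Γ : List S} x → Renaming Δ Γ → Renaming (x ++ Δ) (x ++ Γ)
  lift []      ρ i           = ρ i
  lift (s ∷ x) ρ (here eq)   = here eq
  lift (s ∷ x) ρ (there i)   = there (lift x ρ i)

  -- A context for n parameter tuples at once: a single formula can then mention φ(x,y_k) for all k,
  -- with `copy k` selecting the k-th block.
  repeat : ∀ {S : Set} → ℕ → List S → List S
  repeat zero    y = []
  repeat (suc n) y = y ++ repeat n y

  copy : ∀ {S : Set} {n} {y : List S} → Fin n → Renaming y (repeat n y)
  copy zero            i = ∈-++⁺ˡ i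
  copy {y = y} (suc k) i = ∈-++⁺ʳ y (copy k i)

  module _ {S : Set} {P : S → Set} where

    record Pullback {Δ Γ : List S} (ρ : Renaming Δ Γ) (a′ : All P Δ) (a : All P Γ) : Set where
      field
        at : ∀ {s} (i : s ∈ Δ) → All.lookup a′ i ≡ All.lookup a (ρ i)
    open Pullback public

    lift-pullback : ∀ {x Δ Γ} {ρ : Renaming Δ Γ} {a′ a} (b : All P x) →
                    Pullback ρ a′ a → Pullback (lift x ρ) (++⁺ b a′) (++⁺ b a)
    lift-pullback []      pb .at i             = at pb i
    lift-pullback (_ ∷ b) pb .at (here ≡.refl) = ≡.refl
    lift-pullback (_ ∷ b) pb .at (there i)     = lift-pullback b pb .at i

    join : ∀ {n y} → (Fin n → All P y) → All P (repeat n y)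
    join {zero}  e = []
    join {suc n} e = ++⁺ (e zero) (join (e ∘ suc))

    lookup-++⁺ˡ : ∀ {x y s} (a : All P x) (b : All P y) (i : s ∈ x) →
                  All.lookup a i ≡ All.lookup (++⁺ a b) (∈-++⁺ˡ i)
    lookup-++⁺ˡ (_ ∷ a) b (here ≡.refl) = ≡.refl
    lookup-++⁺ˡ (_ ∷ a) b (there i)     = lookup-++⁺ˡ a b i

    lookup-++⁺ʳ : ∀ {x y s} (a : All P x) (b : All P y) (i : s ∈ y) →
                  All.lookup b i ≡ All.lookup (++⁺ a b) (∈-++⁺ʳ x i)
    lookup-++⁺ʳ []      b i = ≡.refl
    lookup-++⁺ʳ (_ ∷ a) b i = lookup-++⁺ʳ a b i

    copy-pullback : ∀ {n y} (e : Fin n → All P y) k → Pullback (copy k) (e k) (join e)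
    copy-pullback e zero    .at i = lookup-++⁺ˡ (e zero) _ i
    copy-pullback e (suc k) .at i =
      ≡.trans (copy-pullback (e ∘ suc) k .at i) (lookup-++⁺ʳ (e zero) _ (copy k i))

  map-pullback : ∀ {S : Set} {P Q : S → Set} {Δ Γ} {ρ : Renaming Δ Γ} {a′ : All P Δ} {a}
                 (f : ∀ {s} → P s → Q s) → Pullback ρ a′ a →
                 Pullback ρ (All.map f a′) (All.map f a)
  map-pullback {ρ = ρ} {a′} {a} f pb .at i = ≡.trans (lookup-map a′ i)
    (≡.trans (≡.cong f (at pb i)) (≡.sym (lookup-map a (ρ i))))

  module _ {L : Language} where

    open Language L

    renameᵗ  : ∀ {Δ Γ s} → Renaming Δ Γ → Term L Δ s → Term L Γ s
    renameᵗˢ : ∀ {Δ Γ x} → Renaming Δ Γ → All (Term L Δ) x → All (Term L Γ) x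
    renameᵗ ρ (var i)    = var (ρ i)
    renameᵗ ρ (app f ts) = app f (renameᵗˢ ρ ts)
    renameᵗˢ ρ []       = []
    renameᵗˢ ρ (t ∷ ts) = renameᵗ ρ t ∷ renameᵗˢ ρ ts

    -- Quantifiers carry a proof that the values of their body are nonnegative. Hence renaming is
    -- defined together with `K-rename`, which transports that proof by showing that no new values
    -- arise.
    rename   : ∀ {Δ Γ} → Renaming Δ Γ → Formula L Δ → Formula L Γ
    K-rename : ∀ {Δ Γ} (ρ : Renaming Δ Γ) (φ : Formula L Δ) {r} → K L (rename ρ φ) r → K L φ r
    rename ρ (dist t t′)       = dist (renameᵗ ρ t) (renameᵗ ρ t′)
    rename ρ (pred P ts)       = pred P (renameᵗˢ ρ ts)
    rename ρ (conn u u-cont φ) = conn u u-cont (λ i → rename ρ (φ i))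
    rename ρ (sup x ψ nonNeg)  = sup x (rename (lift x ρ) ψ) λ r → nonNeg r ∘ K-rename (lift x ρ) ψ
    rename ρ (inf x ψ nonNeg)  = inf x (rename (lift x ρ) ψ) λ r → nonNeg r ∘ K-rename (lift x ρ) ψ
    K-rename ρ (dist t t′)  k = k
    K-rename ρ (pred P ts)  k = k
    K-rename ρ (conn u _ φ) (v , k , r≈uv) = v , (λ i → K-rename ρ (φ i) (k i)) , r≈uv
    K-rename ρ (sup x ψ _)  k = K-rename (lift x ρ) ψ k
    K-rename ρ (inf x ψ _)  k = K-rename (lift x ρ) ψ k

    module _ (M : Structure L) where

      open Structure M

      eval-renameᵗ  : ∀ {Δ Γ s} {ρ : Renaming Δ Γ} {a′ a} → Pullback ρ a′ a →
                      (t : Term L Δ s) → evalᵗ M (renameᵗ ρ t) a ≡ evalᵗ M t a′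
      eval-renameᵗˢ : ∀ {Δ Γ x} {ρ : Renaming Δ Γ} {a′ a} → Pullback ρ a′ a →
                      (ts : All (Term L Δ) x) → evalᵗˢ M (renameᵗˢ ρ ts) a ≡ evalᵗˢ M ts a′
      eval-renameᵗ pb (var i)    = ≡.sym (at pb i)
      eval-renameᵗ pb (app f ts) = ≡.cong (fun f) (eval-renameᵗˢ pb ts)
      eval-renameᵗˢ pb []       = ≡.refl
      eval-renameᵗˢ pb (t ∷ ts) = ≡.cong₂ _∷_ (eval-renameᵗ pb t) (eval-renameᵗˢ pb ts)

      -- At a quantifier the same witness `b` serves on both sides, so the two sets of reals have
      -- the same members and `supremum-cong` or `infimum-cong` applies.
      eval-rename : ∀ {Δ Γ} {ρ : Renaming Δ Γ} {a′ a} → Pullback ρ a′ a →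
                    (φ : Formula L Δ) → eval M (rename ρ φ) a ≈ eval M φ a′
      eval-rename pb (dist {s = s} t t′) =
        ≈-reflexive (≡.cong₂ (λ b b′ → ι (distₛ s b b′)) (eval-renameᵗ pb t) (eval-renameᵗ pb t′))
      eval-rename pb (pred P ts) = ≈-reflexive (≡.cong (rel P) (eval-renameᵗˢ pb ts))
      eval-rename pb (conn u u-cont φ) = continuous⇒cong u-cont λ i → eval-rename pb (φ i)
      eval-rename pb (sup x ψ _) = ι-cong (supremum-cong
        (λ { t (b , eq) → b , λ n → ℝ.trans (ℝ.sym (eval-rename (lift-pullback b pb) ψ n)) (eq n) })
        (λ { t (b , eq) → b , λ n → ℝ.trans (eval-rename (lift-pullback b pb) ψ n) (eq n) }))
      eval-rename pb (inf x ψ _) = ι-cong (infimum-cong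
        (λ { t (b , eq) → b , λ n → ℝ.trans (ℝ.sym (eval-rename (lift-pullback b pb) ψ n)) (eq n) })
        (λ { t (b , eq) → b , λ n → ℝ.trans (eval-rename (lift-pullback b pb) ψ n) (eq n) }))

    -- Approximate realization of a type inside M.

    module _ {M : Structure L} {x y : Context L} {φ : Formula L (x ++ y)} (p : φType M x y φ) where

      open Structure M
      open φType p
      open _≼_ M≼N
      open ≤-Reasoning

      -- With r the values of φ(p,·) at n parameters from M, the formula
      -- inf_x max_k 𝔡(φ(x,y_k), r_k) vanishes in the extension at those
      -- parameters, hence also in M.
      approximate : ∀ {n} (e : Fin n → Tuple y) {η} → 0# < η →
                    ∃ λ a → ∀ k → 𝔡 (eval₂ M φ a (e k)) (value (e k)) < η
      approximate {n} e {η} 0<η =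
        let t , (a , eq) , t<η = glb-near isGlb-M inf-M<η
        in a , λ k → begin-strict
          𝔡 (eval₂ M φ a (e k)) (value (e k))
            ≤⟨ 𝔡-≈ˡ (λ n → ℝ.sym (eval-rename M (lift-pullback a (copy-pullback e k)) φ n)) ⟩
          𝔡 (eval M (instances k) (++⁺ a params)) (value (e k))
            ≤⟨ 𝔡≤maxDistance (value ∘ e) _ k ⟩
          maxDistance (value ∘ e) (λ k → eval M (instances k) (++⁺ a params))
            ≈⟨ ι-injective eq ⟩
          t
            <⟨ t<η ⟩
          η
            ∎
        where
        instances : Fin n → Formula L (x ++ repeat n y)
        instances k = rename (lift x (copy k)) φ

        error : Formula L (x ++ repeat n y)
        error = conn (distanceTo (value ∘ e)) (distanceTo-continuous (value ∘ e)) instances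

        error-nonNeg : ∀ r → K L error r → ℝ≥0 r
        error-nonNeg r (v , _ , r≈) = _ , 0≤maxDistance (value ∘ e) v , r≈

        params : Tuple (repeat n y)
        params = join e

        errors : (Q : Structure L) → Structure.Tuple Q (repeat n y) → Pred ℝ 0ℓ
        errors Q a t = ∃ λ b → eval Q error (++⁺ b a) ≈ ι t

        -- The tuple argument makes the set of errors inhabited, and 0 bounds it below. In M the
        -- tuple consists of the chosen points of the sorts; in the extension it is the realization.
        isGlb : ∀ Q a → Structure.Tuple Q x → IsGlb _≤_ (errors Q a) (infimum (errors Q a))
        isGlb Q a b = infimum-isGlb (_ , b , λ _ → ℝ.refl) (0# , λ { t (c , eq) →
          ℝ.≤-respʳ-≈ (ι-injective eq) (0≤maxDistance (value ∘ e) _) })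

        isGlb-M : IsGlb _≤_ (errors M params) (infimum (errors M params))
        isGlb-M = isGlb M params (All.universal (λ s → CompleteMetricSpace.point (space s)) x)

        -- Embedding commutes with reindexing, so block k of `embedˢ params` is the image of `e k`,
        -- where `realizes` applies.
        realized : ∀ k → eval extension (instances k) (++⁺ realization (embedˢ params)) ≈ value (e k)
        realized k n = ℝ.trans
          (eval-rename extension (lift-pullback realization (map-pullback embed (copy-pullback e k))) φ n)
          (realizes (e k) n)

        inf-M<η : infimum (errors M params) < η
        inf-M<η = begin-strict
          infimum (errors M params)
            ≈⟨ ι-injective (elementary (inf x error error-nonNeg) params) ⟨
          infimum (errors extension (embedˢ params))
            -- The realization of p is itself a competitor for the infimum, and its error is 0.
            ≤⟨ proj₁ (isGlb extension (embedˢ params) realization) _ (realization , λ _ → ℝ.refl) ⟩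
          maxDistance (value ∘ e) (λ k → eval extension (instances k) (++⁺ realization (embedˢ params)))
            ≤⟨ ≈⇒maxDistance≤0 (value ∘ e) _ realized ⟩
          0#
            <⟨ 0<η ⟩
          η
            ∎

proposition3p3 : (em : ∀ {ℓ} → ExcludedMiddle ℓ)
    (R : CompleteOrderedField) (E : Values.IsometricCopy R) →
    let open ContinuousLogic em R E in
    (L : Language) (M : Structure L) →
    let open Structure M using (Tuple) in
    (x y : Context L) (φ : Formula L (x ++ y)) →
    (ε : ℝ) → 0# < ε → Stable M x y ε φ →
    (γ δ : ℝ) → 0# < δ → δ < γ →
    (p : φType M x y φ) →
    Σ ℕ λ n → Σ (Fin n → Tuple x) λ a →
    (b c : Tuple y) →
    (∀ i → 𝔡 (eval₂ M φ (a i) b) (eval₂ M φ (a i) c) < δ) →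
    𝔡 (φType.value p b) (φType.value p c) < (1# + 1#) * ε + γ
proposition3p3 em R E L M x y φ ε 0<ε stable γ δ 0<δ δ<γ p =
  -- The determining list becomes a family indexed by its positions; `approximate p` supplies the
  -- finite realizability of p.
  let h , determined = FiniteDetermination.finitely-determined em R 𝔡 𝔡-sym 𝔡-triangle
        (eval₂ M φ) (φType.value p) (approximate p) stable δ<γ
  in length h , lookup h , λ b c near → determined b c (All-lookup⁺ h near)
  where
  open ContinuousLogic em R E
  open Distance em R using (𝔡-sym; 𝔡-triangle)
  open Logic em R E using (approximate)
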